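{- Let $n\ge 1$, let $\varphi$ be a decreasing nonnegative weight function on the adjacent transpositions of $\mathbb{S}_n$, and let $\mathsf{d}_\varphi$ be the weighted Kendall distance with weight function $\varphi$. For all rankings $\pi,\sigma\in\mathbb{S}_n$, $$\mathsf{d}_\varphi(\pi,\sigma)=\sum_{i=1}^{n}\frac12\left(\sum_{j=\pi^{ -1}(i)}^{\ell_i-1}\varphi_{(j\ j+1)}+\sum_{j=\sigma^{ -1}(i)}^{\ell_i-1}\varphi_{(j\ j+1)}\right),$$ where $\ell_i=\left(\pi^{ -1}(i)+\sigma^{ -1}(i)+I_i(\pi,\sigma)\right)/2$.
   Context: $\mathbb{S}_n$ is the symmetric group on $[n]=\{1,\dots,n\}$. A permutation $\pi$ is viewed as the ranking $\pi(1)\pi(2)\cdots\pi(n)$, so $\pi^{ -1}(a)$ is the position of element $a$. Products are compositions, $(\pi\sigma)(i)=\pi(\sigma(i))$, so $\pi(a\ b)$ is obtained from $\pi$ by swapping the elements in positions $a$ and $b$. An adjacent transposition is one of the form $(a\ a+1)$, $a\in[n-1]$. $A(\pi,\sigma)$ is the set of all finite sequences $(\tau_1,\dots,\tau_m)$, $m\ge 0$, of adjacent transpositions with $\sigma=\pi\tau_1\cdots\tau_m$ (the empty sequence is allowed when $\pi=\sigma$). For a nonnegative weight function $\varphi$, $\tau\mapsto\varphi_\tau$, on the adjacent transpositions, the weighted Kendall distance is $$\mathsf{d}_\varphi(\pi,\sigma)=\min_{(\tau_1,\dots,\tau_m)\in A(\pi,\sigma)}\sum_{i=1}^m\varphi_{\tau_i}.$$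 $\varphi$ is decreasing if $i>j$ implies $\varphi_{(i\ i+1)}\le\varphi_{(j\ j+1)}$. Rankings $\pi,\sigma$ disagree on a pair $\{i,j\}$ of distinct elements if one places $i$ before $j$ and the other places $j$ before $i$. $I_i(\pi,\sigma)$ is the number of elements $j\in[n]$ such that $\pi$ and $\sigma$ disagree on $\{i,j\}$. An empty sum is $0$. -}

module Defs where

open import Algebra.Bundles using (CommutativeRing)
open import Data.Fin.Base as Fin using (Fin; toℕ; inject₁)
import Data.Fin.Properties as Fin
open import Data.Fin.Permutation
  using (Permutation′; _⟨$⟩ˡ_; _∘ₚ_; transpose; _≈_)
open import Data.List.Base
  using (List; map; foldl; foldr; filter; length; allFin)
open import Data.Nat.Base using (ℕ; suc; _+_; _<_)
open import Data.Nat.DivMod using (_/_)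
import Data.Nat.Properties as ℕ
open import Data.Product.Base using (_×_; _,_; ∃-syntax)
open import Data.Sum.Base using (_⊎_)
open import Level using (_⊔_) renaming (suc to lsuc)
open import Relation.Binary.Core using (Rel)
open import Relation.Binary.Structures using (IsPartialOrder)
open import Relation.Nullary using (Dec; _×-dec_; _⊎-dec_)

------------------------------------------------------------------------
-- Scalars

-- There is no type of real numbers in the library, so weights take values
-- in an arbitrary ordered commutative ring in which 2 is invertible.  Every
-- ordered field is an example, in particular ℝ and ℚ.  Totality and
-- decidability of the order are deliberately not required, so that
-- constructive versions of ℝ are covered too.

record OrderedRingWithHalf c ℓ₁ ℓ₂ : Set (lsuc (c ⊔ ℓ₁ ⊔ ℓ₂)) where
  field
    commutativeRing : CommutativeRing c ℓ₁

  open CommutativeRing commutativeRing public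
    renaming (_+_ to _+ᴿ_; _*_ to _*ᴿ_; _≈_ to _≈ᴿ_)

  infix 4 _≤ᴿ_

  field
    _≤ᴿ_           : Rel Carrier ℓ₂
    isPartialOrder : IsPartialOrder _≈ᴿ_ _≤ᴿ_
    +-mono-≤       : ∀ {x y u v} → x ≤ᴿ y → u ≤ᴿ v → x +ᴿ u ≤ᴿ y +ᴿ v
    *-nonNeg       : ∀ {x y} → 0# ≤ᴿ x → 0# ≤ᴿ y → 0# ≤ᴿ x *ᴿ y
    ½              : Carrier
    ½+½≈1          : ½ +ᴿ ½ ≈ᴿ 1#

  module Order = IsPartialOrder isPartialOrder

------------------------------------------------------------------------
-- Rankings

-- With n = suc m, elements and positions are both Fin (suc m), that is,
-- 0-based; π sends a position to the element placed there.

Ranking : ℕ → Set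
Ranking n = Permutation′ n

-- π⁻¹(i), 1-based.
position : ∀ {n} → Ranking n → Fin n → ℕ
position π i = suc (toℕ (π ⟨$⟩ˡ i))

infixl 7 _·_

-- (π · τ)(i) = π(τ(i)); the library's _∘ₚ_ composes in the opposite order.
_·_ : ∀ {n} → Ranking n → Ranking n → Ranking n
π · τ = τ ∘ₚ π

-- The adjacent transpositions of 𝕊_{m+1} are indexed by Fin m: the index a
-- stands for the transposition (j j+1) with j = suc (toℕ a).
adjacent : ∀ {m} → Fin m → Permutation′ (suc m)
adjacent a = transpose (inject₁ a) (Fin.suc a)

-- (… ((π τ₁) τ₂) …) τₖ
applyAll : ∀ {m} → Ranking (suc m) → List (Fin m) → Ranking (suc m)
applyAll = foldl (λ ρ a → ρ · adjacent a)

-- Membership of a sequence of adjacent transpositions in A(π,σ).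
A : ∀ {m} → Ranking (suc m) → Ranking (suc m) → List (Fin m) → Set
A π σ τs = σ ≈ applyAll π τs

Before : ∀ {n} → Ranking n → Fin n → Fin n → Set
Before π i j = position π i < position π j

-- Disagree π σ i i is empty, so distinctness of i and j is automatic.
Disagree : ∀ {n} → Ranking n → Ranking n → Fin n → Fin n → Set
Disagree π σ i j =
  (Before π i j × Before σ j i) ⊎ (Before π j i × Before σ i j)

before? : ∀ {n} (π : Ranking n) (i j : Fin n) → Dec (Before π i j)
before? π i j = position π i ℕ.<? position π j

disagree? : ∀ {n} (π σ : Ranking n) (i j : Fin n) → Dec (Disagree π σ i j)
disagree? π σ i j =
  (before? π i j ×-dec before? σ j i) ⊎-dec (before? π j i ×-dec before? σ i j)

I : ∀ {n} → Ranking n → Ranking n → Fin n → ℕ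
I {n} π σ i = length (filter (disagree? π σ i) (allFin n))

-- The numerator is always even: π⁻¹(i) − σ⁻¹(i) is the number of elements
-- before i in π only minus the number before i in σ only, and I is the sum
-- of these two numbers.  Hence the natural-number division is exact.
ℓ : ∀ {n} → Ranking n → Ranking n → Fin n → ℕ
ℓ π σ i = (position π i + position σ i + I π σ i) / 2

------------------------------------------------------------------------
-- Weights and the weighted Kendall distance

module Weighted {c ℓ₁ ℓ₂} (R : OrderedRingWithHalf c ℓ₁ ℓ₂) where
  open OrderedRingWithHalf R

  ∑ : ∀ {a} {X : Set a} → List X → (X → Carrier) → Carrier
  ∑ xs f = foldr _+ᴿ_ 0# (map f xs)

  Weight : ℕ → Set c
  Weight m = Fin m → Carrier

  NonNegative : ∀ {m} → Weight m → Set ℓ₂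
  NonNegative φ = ∀ a → 0# ≤ᴿ φ a

  Decreasing : ∀ {m} → Weight m → Set ℓ₂
  Decreasing φ = ∀ i j → i Fin.> j → φ i ≤ᴿ φ j

  IsMinimum : ∀ {p} → (Carrier → Set p) → Carrier → Set (c ⊔ ℓ₂ ⊔ p)
  IsMinimum P d = P d × (∀ x → P x → d ≤ᴿ x)

  minimum-unique : ∀ {p} {P : Carrier → Set p} {d e} →
                   IsMinimum P d → IsMinimum P e → d ≈ᴿ e
  minimum-unique (Pd , d≤) (Pe , e≤) = Order.antisym (d≤ _ Pe) (e≤ _ Pd)

  -- The set over which the minimum is taken: x is the total weight of some
  -- sequence in A(π,σ).
  TotalWeight : ∀ {m} → Weight m → Ranking (suc m) → Ranking (suc m) →
                Carrier → Set ℓ₁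
  TotalWeight φ π σ x = ∃[ τs ] A π σ τs × x ≈ᴿ ∑ τs φ

  -- "d_φ(π,σ) = d".  A relation rather than a function, since the order on
  -- the scalars is not assumed decidable; d is determined up to ≈ᴿ by
  -- minimum-unique.
  IsKendallDistance : ∀ {m} → Weight m → Ranking (suc m) → Ranking (suc m) →
                      Carrier → Set (c ⊔ ℓ₁ ⊔ ℓ₂)
  IsKendallDistance φ π σ d = IsMinimum (TotalWeight φ π σ) d

  -- The sum of φ_(j j+1) over p ≤ j ≤ q − 1, where a has j = suc (toℕ a).
  -- Only j ≤ m occur, which loses nothing for q = ℓ π σ i: at most
  -- (n − π⁻¹(i)) + (n − σ⁻¹(i)) elements j disagree with i, as each is
  -- placed after i in π or in σ, so ℓ π σ i ≤ n = suc m.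
  ∑range : ∀ {m} → Weight m → ℕ → ℕ → Carrier
  ∑range {m} φ p q =
    ∑ (filter (λ a → (p ℕ.≤? suc (toℕ a)) ×-dec (suc (toℕ a) ℕ.<? q)) (allFin m)) φ

{-# OPTIONS --safe #-}
module Submission where

-- ℓ π σ i is the number of elements weakly before i in π or in σ.  Exchanging
-- neighbours x y of π that σ orders as y before x therefore lowers ℓ at y by
-- one and leaves it fixed elsewhere.
-- Put Φ q = ∑_{j<q} φ_(j j+1), T π = ∑ᵢ Φ(ℓ π σ i) and C = ∑ᵢ Φ(σ⁻¹(i)).  As
-- ∑ᵢ Φ(π⁻¹(i)) is also C, the formula equals T π − C, which vanishes at π = σ.
-- If x and y stand at places a and a+1, the exchange lowers T by φ_(j j+1),
-- where j+1 is the old value of ℓ at y.  Since j ≥ a and φ is decreasing, this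
-- is at most φ_(a a+1); an exchange of neighbours on which π and σ agree does
-- not lower T at all.  This is the lower bound.  The loss is exactly φ_(a a+1)
-- when all elements before y in σ are also before y in π, and an exchange of
-- this kind exists as long as π ≠ σ.

open import Defs
open import Algebra.Bundles using (CommutativeMonoid)
import Algebra.Properties.CommutativeMonoid.Sum as Sum
import Algebra.Properties.CommutativeSemigroup as CommutativeSemigroup
import Algebra.Properties.Group as Group
open import Data.Bool.Base using (true; false; if_then_else_)
open import Data.Bool.Properties using (if-cong)
open import Data.Fin.Base as Fin using (Fin; zero; suc; toℕ; inject₁; fromℕ<; punchIn)
import Data.Fin.Properties as Fin
open import Data.Fin.Permutation using (_⟨$⟩ˡ_; _⟨$⟩ʳ_; _≈_; flip; inverseˡ; inverseʳ)
open import Data.List.Base using ([]; _∷_; map; foldr; filter; length; tabulate; allFin)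
open import Data.Nat.Base using (ℕ; zero; suc; _+_; _*_; _<_; _≤_; z≤n; s≤s; s≤s⁻¹)
open import Data.Nat.DivMod using (_/_; m*n/n≡m)
import Data.Nat.Properties as ℕ
open import Data.Product.Base using (_×_; _,_; ∃-syntax; proj₁; proj₂)
open import Data.Sum.Base using (_⊎_; inj₁; inj₂; [_,_]′; swap)
open import Function.Base using (_∘_; id)
open import Function.Bundles using (mk⇔)
open import Relation.Binary.PropositionalEquality as ≡ using (_≡_; _≢_; cong; cong₂; subst; subst₂)
open import Relation.Binary.Bundles using (Poset)
open import Relation.Binary.Definitions using (Tri; tri<; tri≈; tri>)
import Relation.Binary.Reasoning.PartialOrder as PartialOrderReasoning
import Relation.Binary.Reasoning.Setoid as SetoidReasoning
open import Relation.Nullary using (¬_; Dec; yes; no; does; contradiction; _×-dec_; _⊎-dec_)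
open import Relation.Nullary.Decidable using (does-⇔; dec-true; dec-false)
open import Relation.Unary using (Pred; Decidable)

-- Finite sums in a commutative monoid.

module FiniteSums {c ℓ} (M : CommutativeMonoid c ℓ) where
  open CommutativeMonoid M renaming (_≈_ to _≈ᴹ_)
  open Sum M public
  open CommutativeSemigroup commutativeSemigroup using (x∙yz≈y∙xz)

  -- Subtraction-free form of `sum f − sum g = f i − g i`, so that it serves natural numbers and
  -- scalars alike.
  sum-differ : ∀ {n} (f g : Fin n → Carrier) i → (∀ j → j ≢ i → f j ≈ᴹ g j) →
               g i ∙ sum f ≈ᴹ f i ∙ sum g
  sum-differ {suc n} f g i f≈g = begin
    g i ∙ sum f                                ≈⟨ ∙-congˡ (sum-remove f) ⟩
    g i ∙ (f i ∙ sum (λ j → f (punchIn i j)))  ≈⟨ x∙yz≈y∙xz _ _ _ ⟩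
    f i ∙ (g i ∙ sum (λ j → f (punchIn i j)))
      ≈⟨ ∙-congˡ (∙-congˡ (sum-cong-≋ λ j → f≈g (punchIn i j) (Fin.punchInᵢ≢i i j))) ⟩
    f i ∙ (g i ∙ sum (λ j → g (punchIn i j)))  ≈⟨ ∙-congˡ (sum-remove g) ⟨
    f i ∙ sum g                                ∎
    where open SetoidReasoning setoid

  foldr-filter-tabulate :
    ∀ {n a p} {X : Set a} {P : Pred X p} (P? : Decidable P) (f : X → Carrier) (g : Fin n → X) →
    foldr _∙_ ε (map f (filter P? (tabulate g))) ≈ᴹ sum (λ i → if does (P? (g i)) then f (g i) else ε)
  foldr-filter-tabulate {zero}  P? f g = refl
  foldr-filter-tabulate {suc n} P? f g with does (P? (g zero))
  ... | true  = ∙-congˡ (foldr-filter-tabulate P? f (g ∘ suc))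
  ... | false = trans (foldr-filter-tabulate P? f (g ∘ suc)) (sym (identityˡ _))

  foldr-tabulate : ∀ {n a} {X : Set a} (f : X → Carrier) (g : Fin n → X) →
                   foldr _∙_ ε (map f (tabulate g)) ≈ᴹ sum (f ∘ g)
  foldr-tabulate {zero}  f g = refl
  foldr-tabulate {suc n} f g = ∙-congˡ (foldr-tabulate f (g ∘ suc))

open FiniteSums ℕ.+-0-commutativeMonoid using (sum)
private module ℕ-Sum = FiniteSums ℕ.+-0-commutativeMonoid

-- Indicators and counting.

[_] : ∀ {p} {P : Set p} → Dec P → ℕ
[ P? ] = if does P? then 1 else 0

[]-cong : ∀ {p q} {P : Set p} {Q : Set q} (P? : Dec P) (Q? : Dec Q) →
          (P → Q) → (Q → P) → [ P? ] ≡ [ Q? ]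
[]-cong P? Q? P→Q Q→P = if-cong (does-⇔ (mk⇔ P→Q Q→P) P? Q?)

[]-true : ∀ {p} {P : Set p} (P? : Dec P) → P → [ P? ] ≡ 1
[]-true P? P = if-cong (dec-true P? P)

[]-false : ∀ {p} {P : Set p} (P? : Dec P) → ¬ P → [ P? ] ≡ 0
[]-false P? ¬P = if-cong (dec-false P? ¬P)

count : ∀ {n p} {P : Pred (Fin n) p} → Decidable P → ℕ
count P? = sum (λ i → [ P? i ])

count-cong : ∀ {n p q} {P : Pred (Fin n) p} {Q : Pred (Fin n) q} (P? : Decidable P) (Q? : Decidable Q) →
             (∀ i → P i → Q i) → (∀ i → Q i → P i) → count P? ≡ count Q?
count-cong {n} P? Q? P⊆Q Q⊆P = ℕ-Sum.sum-cong-≗ {n} λ i → []-cong (P? i) (Q? i) (P⊆Q i) (Q⊆P i)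

count-mono-≤ : ∀ {n p q} {P : Pred (Fin n) p} {Q : Pred (Fin n) q} (P? : Decidable P) (Q? : Decidable Q) →
               (∀ i → P i → Q i) → count P? ≤ count Q?
count-mono-≤ {zero}  P? Q? P⊆Q = z≤n
count-mono-≤ {suc n} P? Q? P⊆Q =
  ℕ.+-mono-≤ head (count-mono-≤ (P? ∘ suc) (Q? ∘ suc) (λ i → P⊆Q (suc i)))
  where
  head : [ P? zero ] ≤ [ Q? zero ]
  head with P? zero
  ... | yes p = ℕ.≤-reflexive (≡.sym ([]-true (Q? zero) (P⊆Q zero p)))
  ... | no  _ = z≤n

length-filter-tabulate :
  ∀ {n a p} {X : Set a} {P : Pred X p} (P? : Decidable P) (g : Fin n → X) →
  length (filter P? (tabulate g)) ≡ count (P? ∘ g)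
length-filter-tabulate {zero}  P? g = ≡.refl
length-filter-tabulate {suc n} P? g with does (P? (g zero))
... | true  = cong suc (length-filter-tabulate P? (g ∘ suc))
... | false = length-filter-tabulate P? (g ∘ suc)

count-≤ : ∀ {n} (k : Fin n) → count (λ (i : Fin n) → toℕ i ℕ.≤? toℕ k) ≡ suc (toℕ k)
count-≤ {suc n} zero    = cong suc (ℕ-Sum.sum-replicate-zero n)
count-≤ {suc n} (suc k) = cong suc (≡.trans
  (count-cong (λ (i : Fin n) → suc (toℕ i) ℕ.≤? suc (toℕ k)) (λ i → toℕ i ℕ.≤? toℕ k) (λ _ → s≤s⁻¹) (λ _ → s≤s))
  (count-≤ k))

-- `ℓ` as the size of a union of two initial segments.

precedes? : ∀ {n} (P S : Fin n → ℕ) (i j : Fin n) → Dec (P j ≤ P i ⊎ S j ≤ S i)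
precedes? P S i j = (P j ℕ.≤? P i) ⊎-dec (S j ℕ.≤? S i)

span : ∀ {n} → (Fin n → ℕ) → (Fin n → ℕ) → Fin n → ℕ
span P S i = count (precedes? P S i)

position-injective : ∀ {n} (π : Ranking n) {i j} → position π i ≡ position π j → i ≡ j
position-injective π {i} {j} eq = ≡.trans (≡.sym (inverseʳ π))
  (≡.trans (cong (π ⟨$⟩ʳ_) (Fin.toℕ-injective (ℕ.suc-injective eq))) (inverseʳ π))

position≡count : ∀ {n} (π : Ranking n) i →
                 position π i ≡ count (λ j → position π j ℕ.≤? position π i)
position≡count {n} π i = begin
  position π i                                          ≡⟨ count-≤ (π ⟨$⟩ˡ i) ⟨
  count (λ (p : Fin n) → toℕ p ℕ.≤? toℕ (π ⟨$⟩ˡ i))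
    ≡⟨ ℕ-Sum.sum-permute {n} (λ p → [ toℕ p ℕ.≤? toℕ (π ⟨$⟩ˡ i) ]) (flip π) ⟩
  count (λ j → toℕ (π ⟨$⟩ˡ j) ℕ.≤? toℕ (π ⟨$⟩ˡ i))
    ≡⟨ count-cong (λ j → toℕ (π ⟨$⟩ˡ j) ℕ.≤? toℕ (π ⟨$⟩ˡ i)) (λ j → position π j ℕ.≤? position π i)
                  (λ _ → s≤s) (λ _ → s≤s⁻¹) ⟩
  count (λ j → position π j ℕ.≤? position π i)          ∎
  where open ≡.≡-Reasoning

position≤span : ∀ {n} (π : Ranking n) (S : Fin n → ℕ) i → position π i ≤ span (position π) S i
position≤span π S i = subst (_≤ span (position π) S i) (≡.sym (position≡count π i))
  (count-mono-≤ (λ j → position π j ℕ.≤? position π i) (precedes? (position π) S i) (λ _ → inj₁))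

-- The hypothesis puts one initial segment inside the other, so the union is the larger one. Applied
-- when the two rankings coincide and to tight exchanges.
span≡position : ∀ {n} (π : Ranking n) (S : Fin n → ℕ) i →
                (∀ j → S j ≤ S i → position π j ≤ position π i) →
                span (position π) S i ≡ position π i
span≡position π S i h = ≡.trans
  (count-cong (precedes? (position π) S i) (λ j → position π j ℕ.≤? position π i)
    (λ j → [ id , h j ]′) (λ _ → inj₁))
  (≡.sym (position≡count π i))

span-comm : ∀ {n} (P S : Fin n → ℕ) i → span P S i ≡ span S P i
span-comm P S i = count-cong (precedes? P S i) (precedes? S P i) (λ _ → swap) (λ _ → swap)

-- One element's share of |P| + |S| + |P △ S| = 2 |P ∪ S|: the four hypotheses make D the symmetric
-- difference.
union+union : ∀ {p s d} {P : Set p} {S : Set s} {D : Set d} (P? : Dec P) (S? : Dec S) (D? : Dec D) →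
              (P → ¬ S → D) → (S → ¬ P → D) → (D → P → ¬ S) → (D → P ⊎ S) →
              [ P? ] + [ S? ] + [ D? ] ≡ [ P? ⊎-dec S? ] + [ P? ⊎-dec S? ]
union+union (yes p) (yes s) D? pd sd ds d = cong (2 +_) ([]-false D? λ x → ds x p s)
union+union (yes p) (no ¬s) D? pd sd ds d = cong (1 +_) ([]-true D? (pd p ¬s))
union+union (no ¬p) (yes s) D? pd sd ds d = cong (1 +_) ([]-true D? (sd s ¬p))
union+union (no ¬p) (no ¬s) D? pd sd ds d =
  []-false D? λ x → [ ¬p , ¬s ]′ (d x)

ℓ≡span : ∀ {n} (π σ : Ranking n) i → ℓ π σ i ≡ span (position π) (position σ) i
ℓ≡span {n} π σ i = ≡.trans (cong (_/ 2) double) (m*n/n≡m u 2)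
  where
  P = position π
  S = position σ
  u = span P S i
  p? = λ j → P j ℕ.≤? P i
  s? = λ j → S j ℕ.≤? S i
  d? = disagree? π σ i
  u? = precedes? P S i

  pointwise : ∀ j → [ p? j ] + [ s? j ] + [ d? j ] ≡ [ u? j ] + [ u? j ]
  pointwise j = union+union (p? j) (s? j) (d? j)
    -- Disagreement is strict while the segments are weak: a tie would force `j ≡ i`, and `i` lies
    -- in both segments.
    (λ p ¬s → inj₂ (ℕ.≤∧≢⇒< p (λ e → ¬s (ℕ.≤-reflexive (cong S (position-injective π e)))) , ℕ.≰⇒> ¬s))
    (λ s ¬p → inj₁ (ℕ.≰⇒> ¬p , ℕ.≤∧≢⇒< s (λ e → ¬p (ℕ.≤-reflexive (cong P (position-injective σ e))))))
    (λ { (inj₁ (p , _)) q _ → ℕ.<⇒≱ p q ; (inj₂ (_ , s)) _ t → ℕ.<⇒≱ s t })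
    (λ { (inj₁ (_ , s)) → inj₂ (ℕ.<⇒≤ s) ; (inj₂ (p , _)) → inj₁ (ℕ.<⇒≤ p) })

  double : P i + S i + I π σ i ≡ u * 2
  double = begin
    P i + S i + I π σ i
      ≡⟨ cong₂ _+_ (cong₂ _+_ (position≡count π i) (position≡count σ i)) (length-filter-tabulate d? id) ⟩
    count p? + count s? + count d?
      ≡⟨ cong (_+ count d?) (ℕ-Sum.∑-distrib-+ {n} (λ j → [ p? j ]) (λ j → [ s? j ])) ⟨
    sum (λ j → [ p? j ] + [ s? j ]) + count d?
      ≡⟨ ℕ-Sum.∑-distrib-+ {n} (λ j → [ p? j ] + [ s? j ]) (λ j → [ d? j ]) ⟨
    sum (λ j → [ p? j ] + [ s? j ] + [ d? j ])  ≡⟨ ℕ-Sum.sum-cong-≗ {n} pointwise ⟩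
    sum (λ j → [ u? j ] + [ u? j ])             ≡⟨ ℕ-Sum.∑-distrib-+ {n} (λ j → [ u? j ]) (λ j → [ u? j ]) ⟩
    u + u                                       ≡⟨ cong (u +_) (ℕ.+-identityʳ u) ⟨
    2 * u                                       ≡⟨ ℕ.*-comm 2 u ⟩
    u * 2                                       ∎
    where open ≡.≡-Reasoning

-- Exchanging two neighbours and the effect on spans.

-- Phrased through position functions so that it can be reversed by `Exchange-sym`; one set of
-- lemmas then covers both removing and creating a disagreement.
record Exchange {n} (P P′ : Fin n → ℕ) (x y : Fin n) : Set where
  field
    P-injective  : ∀ {i j} → P i ≡ P j → i ≡ j
    P′-injective : ∀ {i j} → P′ i ≡ P′ j → i ≡ j
    consecutive  : P y ≡ suc (P x)
    moved-x      : P′ x ≡ P y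
    moved-y      : P′ y ≡ P x
    unmoved      : ∀ {z} → z ≢ x → z ≢ y → P′ z ≡ P z

  Px<Py : P x < P y
  Px<Py = ℕ.≤-reflexive (≡.sym consecutive)

  -- No third element fits between consecutive places, so the only comparison that the exchange
  -- destroys is that of x with y.
  order-preserved : ∀ {i j} → ¬ (j ≡ x × i ≡ y) → P j ≤ P i → P′ j ≤ P′ i
  order-preserved {i} {j} ≢xy Pj≤Pi with j Fin.≟ x | j Fin.≟ y | i Fin.≟ x | i Fin.≟ y
  ... | yes ≡.refl | _ | yes ≡.refl | _ = ℕ.≤-refl
  ... | yes ≡.refl | _ | no _ | yes ≡.refl = contradiction (≡.refl , ≡.refl) ≢xy
  ... | yes ≡.refl | _ | no i≢x | no i≢y = subst₂ _≤_ (≡.trans (≡.sym consecutive) (≡.sym moved-x))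
          (≡.sym (unmoved i≢x i≢y)) (ℕ.≤∧≢⇒< Pj≤Pi (i≢x ∘ ≡.sym ∘ P-injective))
  ... | no _ | yes ≡.refl | yes ≡.refl | _ = subst₂ _≤_ (≡.sym moved-y) (≡.sym moved-x) (ℕ.<⇒≤ Px<Py)
  ... | no _ | yes ≡.refl | no _ | yes ≡.refl = ℕ.≤-refl
  ... | no _ | yes ≡.refl | no i≢x | no i≢y =
          subst₂ _≤_ (≡.sym moved-y) (≡.sym (unmoved i≢x i≢y)) (ℕ.≤-trans (ℕ.<⇒≤ Px<Py) Pj≤Pi)
  ... | no j≢x | no j≢y | yes ≡.refl | _ =
          subst₂ _≤_ (≡.sym (unmoved j≢x j≢y)) (≡.sym moved-x) (ℕ.≤-trans Pj≤Pi (ℕ.<⇒≤ Px<Py))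
  ... | no j≢x | no j≢y | no _ | yes ≡.refl = subst₂ _≤_ (≡.sym (unmoved j≢x j≢y)) (≡.sym moved-y)
          (s≤s⁻¹ (subst (P j <_) consecutive (ℕ.≤∧≢⇒< Pj≤Pi (j≢y ∘ P-injective))))
  ... | no j≢x | no j≢y | no i≢x | no i≢y =
          subst₂ _≤_ (≡.sym (unmoved j≢x j≢y)) (≡.sym (unmoved i≢x i≢y)) Pj≤Pi

Exchange-sym : ∀ {n} {P P′ : Fin n → ℕ} {x y} → Exchange P P′ x y → Exchange P′ P y x
Exchange-sym e = record
  { P-injective  = P′-injective
  ; P′-injective = P-injective
  ; consecutive  = ≡.trans moved-x (≡.trans consecutive (cong suc (≡.sym moved-y)))
  ; moved-x      = ≡.sym moved-x
  ; moved-y      = ≡.sym moved-y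
  ; unmoved      = λ z≢y z≢x → ≡.sym (unmoved z≢x z≢y)
  }
  where open Exchange e

module _ {n} {P P′ : Fin n → ℕ} {x y} (e : Exchange P P′ x y) (S : Fin n → ℕ) (Sy<Sx : S y < S x) where
  private
    Precedes Precedes′ : Fin n → Fin n → Set
    Precedes  j i = P j ≤ P i ⊎ S j ≤ S i
    Precedes′ j i = P′ j ≤ P′ i ⊎ S j ≤ S i

    to : ∀ {i j} → ¬ (j ≡ x × i ≡ y) → Precedes j i → Precedes′ j i
    to ≢xy (inj₁ p) = inj₁ (Exchange.order-preserved e ≢xy p)
    to ≢xy (inj₂ s) = inj₂ s

    from : ∀ {i j} → Precedes′ j i → Precedes j i
    from {i} {j} (inj₁ p) with (j Fin.≟ y) ×-dec (i Fin.≟ x)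
    -- The only comparison that the exchange creates puts y before x, and `S` had it already.
    ... | yes (≡.refl , ≡.refl) = inj₂ (ℕ.<⇒≤ Sy<Sx)
    ... | no ≢yx = inj₁ (Exchange.order-preserved (Exchange-sym e) ≢yx p)
    from (inj₂ s) = inj₂ s

    lost : ¬ Precedes′ x y
    lost (inj₁ p) = ℕ.<⇒≱ (Exchange.Px<Py (Exchange-sym e)) p
    lost (inj₂ s) = ℕ.<⇒≱ Sy<Sx s

  span-unchanged : ∀ i → i ≢ y → span P S i ≡ span P′ S i
  span-unchanged i i≢y =
    count-cong (precedes? P S i) (precedes? P′ S i) (λ j → to (i≢y ∘ proj₂)) (λ j → from)

  -- Only x leaves the set counted at y: it was there through `P` alone, since `S y < S x`.
  span-drops : span P S y ≡ suc (span P′ S y)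
  span-drops = begin
    span P S y                  ≡⟨ cong (_+ span P S y) ([]-false (after-swap? x) lost) ⟨
    [ after-swap? x ] + span P S y
      ≡⟨ ℕ-Sum.sum-differ (λ j → [ before-swap? j ]) (λ j → [ after-swap? j ]) x
           (λ j j≢x → []-cong (before-swap? j) (after-swap? j) (to (j≢x ∘ proj₁)) from) ⟩
    [ before-swap? x ] + span P′ S y
      ≡⟨ cong (_+ span P′ S y) ([]-true (before-swap? x) (inj₁ (ℕ.<⇒≤ (Exchange.Px<Py e)))) ⟩
    suc (span P′ S y)           ∎
    where
    open ≡.≡-Reasoning
    before-swap? = precedes? P S y
    after-swap?  = precedes? P′ S y

adjacent-exchange : ∀ {m} (π : Ranking (suc m)) (a : Fin m) →
                    Exchange (position π) (position (π · adjacent a)) (π ⟨$⟩ʳ inject₁ a) (π ⟨$⟩ʳ suc a)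
adjacent-exchange π a = record
  { P-injective  = position-injective π
  ; P′-injective = position-injective (π · adjacent a)
  ; consecutive  = ≡.trans position-suc (cong suc (≡.sym position-inject₁))
  ; moved-x      = ≡.trans (cong suc moved₁) (≡.sym position-suc)
  ; moved-y      = ≡.trans (cong (suc ∘ toℕ) moved₂) (cong (suc ∘ toℕ) (≡.sym (inverseˡ π)))
  ; unmoved      = λ z≢x z≢y → cong (suc ∘ toℕ) (fixed z≢x z≢y)
  }
  where
  position-suc : position π (π ⟨$⟩ʳ suc a) ≡ suc (suc (toℕ a))
  position-suc = cong (suc ∘ toℕ) (inverseˡ π)

  position-inject₁ : position π (π ⟨$⟩ʳ inject₁ a) ≡ suc (toℕ a)
  position-inject₁ = cong suc (≡.trans (cong toℕ (inverseˡ π)) (Fin.toℕ-inject₁ a))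

  inject₁≢suc : inject₁ a ≢ suc a
  inject₁≢suc eq = ℕ.1+n≢n (≡.sym (≡.trans (≡.sym (Fin.toℕ-inject₁ a)) (cong toℕ eq)))

  moved₁ : toℕ ((π · adjacent a) ⟨$⟩ˡ (π ⟨$⟩ʳ inject₁ a)) ≡ suc (toℕ a)
  -- The inverse of `transpose i j` tests for `j` first, so that test has to fail before the one for
  -- `inject₁ a` succeeds.
  moved₁ rewrite inverseˡ π {inject₁ a}
               | dec-false (inject₁ a Fin.≟ suc a) inject₁≢suc
               | dec-true (inject₁ a Fin.≟ inject₁ a) ≡.refl = ≡.refl

  moved₂ : (π · adjacent a) ⟨$⟩ˡ (π ⟨$⟩ʳ suc a) ≡ inject₁ a
  moved₂ rewrite inverseˡ π {suc a} | dec-true (suc a Fin.≟ suc a) ≡.refl = ≡.refl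

  fixed : ∀ {z} → z ≢ π ⟨$⟩ʳ inject₁ a → z ≢ π ⟨$⟩ʳ suc a → (π · adjacent a) ⟨$⟩ˡ z ≡ π ⟨$⟩ˡ z
  fixed {z} z≢x z≢y
    rewrite dec-false (π ⟨$⟩ˡ z Fin.≟ suc a) (λ eq → z≢y (≡.trans (≡.sym (inverseʳ π)) (cong (π ⟨$⟩ʳ_) eq)))
          | dec-false (π ⟨$⟩ˡ z Fin.≟ inject₁ a) (λ eq → z≢x (≡.trans (≡.sym (inverseʳ π)) (cong (π ⟨$⟩ʳ_) eq)))
    = ≡.refl

position-cong : ∀ {n} (π σ : Ranking n) → σ ≈ π → ∀ i → position π i ≡ position σ i
position-cong π σ σ≈π i = cong (suc ∘ toℕ) (begin
  π ⟨$⟩ˡ i                      ≡⟨ cong (π ⟨$⟩ˡ_) (inverseʳ σ) ⟨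
  π ⟨$⟩ˡ (σ ⟨$⟩ʳ (σ ⟨$⟩ˡ i))    ≡⟨ cong (π ⟨$⟩ˡ_) (σ≈π (σ ⟨$⟩ˡ i)) ⟩
  π ⟨$⟩ˡ (π ⟨$⟩ʳ (σ ⟨$⟩ˡ i))    ≡⟨ inverseˡ π ⟩
  σ ⟨$⟩ˡ i                      ∎)
  where open ≡.≡-Reasoning

-- Existence of an exchange with exact loss.

first-disagreement : ∀ {n} (π σ : Ranking n) → ¬ (π ≈ σ) →
  ∃[ k ] π ⟨$⟩ʳ k ≢ σ ⟨$⟩ʳ k × (∀ j → j Fin.< k → π ⟨$⟩ʳ j ≡ σ ⟨$⟩ʳ j)
first-disagreement {n} π σ π≉σ
  with Fin.¬∀⟶∃¬-smallest n _ (λ i → π ⟨$⟩ʳ i Fin.≟ σ ⟨$⟩ʳ i) π≉σ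
... | k , πk≢σk , agree = k , πk≢σk , λ j j<k →
  subst (λ j → π ⟨$⟩ʳ j ≡ σ ⟨$⟩ʳ j)
    (Fin.toℕ-injective (≡.trans (Fin.toℕ-inject (fromℕ< j<k)) (Fin.toℕ-fromℕ< j<k)))
    (agree (fromℕ< j<k))

-- The second condition brings the span of y down to the position of y in π, the least value that
-- `position≤span` allows.
Tight : ∀ {m} → Ranking (suc m) → Ranking (suc m) → Fin m → Set
Tight π σ a = Before σ y x × (∀ j → position σ j ≤ position σ y → position π j ≤ position π y)
  where
  x = π ⟨$⟩ʳ inject₁ a
  y = π ⟨$⟩ʳ suc a

-- The element y that σ has at the first place k where the rankings differ is
-- preceded in σ only by elements at places where both rankings agree, and it
-- occurs in π after place k, behind an element that σ puts after y.
tight-exchange : ∀ {m} (π σ : Ranking (suc m)) → ¬ (π ≈ σ) → ∃[ a ] Tight π σ a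
tight-exchange π σ π≉σ with first-disagreement π σ π≉σ
... | k , πk≢σk , agree = result (π ⟨$⟩ˡ y) ≡.refl
  where
  y = σ ⟨$⟩ʳ k

  σ-agree : ∀ z → σ ⟨$⟩ˡ z Fin.< k → π ⟨$⟩ˡ z ≡ σ ⟨$⟩ˡ z
  σ-agree z lt = ≡.trans
    (cong (π ⟨$⟩ˡ_) (≡.sym (≡.trans (agree (σ ⟨$⟩ˡ z) lt) (inverseʳ σ)))) (inverseˡ π)

  k<πy : k Fin.< π ⟨$⟩ˡ y
  k<πy with Fin.<-cmp k (π ⟨$⟩ˡ y)
  ... | tri< lt _ _ = lt
  ... | tri≈ _ eq _ = contradiction (≡.trans (cong (π ⟨$⟩ʳ_) eq) (inverseʳ π)) πk≢σk
  -- If y stood before place k in π, then by agreement σ would have it at that place too, not at k.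
  ... | tri> _ _ gt = contradiction (≡.sym k≡πy) (Fin.<⇒≢ gt)
    where
    k≡πy : k ≡ π ⟨$⟩ˡ y
    k≡πy = ≡.trans (≡.sym (inverseˡ σ)) (≡.trans (cong (σ ⟨$⟩ˡ_)
             (≡.trans (≡.sym (inverseʳ π)) (agree (π ⟨$⟩ˡ y) gt))) (inverseˡ σ))

  -- The place of y in π lies beyond k, hence is a successor `suc a`; this `a` is the witness, and
  -- the exchange moves y one place forward.
  result : ∀ q → π ⟨$⟩ˡ y ≡ q → ∃[ a ] Tight π σ a
  result zero    eq = contradiction (subst (k Fin.<_) eq k<πy) λ ()
  result (suc a) eq =
    a ,
    subst (λ p → suc p < position σ x) (≡.sym σy≡k) (s≤s k<σx) ,
    λ j Sj≤Sy → subst (position π j ≤_) (≡.sym (cong (suc ∘ toℕ) (inverseˡ π)))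
                  (earlier j (ℕ.≤-trans (s≤s⁻¹ Sj≤Sy) (ℕ.≤-reflexive σy≡k)))
    where
    x = π ⟨$⟩ʳ inject₁ a

    πa≡y : π ⟨$⟩ʳ suc a ≡ y
    πa≡y = ≡.trans (cong (π ⟨$⟩ʳ_) (≡.sym eq)) (inverseʳ π)

    σy≡k : toℕ (σ ⟨$⟩ˡ (π ⟨$⟩ʳ suc a)) ≡ toℕ k
    σy≡k = cong toℕ (≡.trans (cong (σ ⟨$⟩ˡ_) πa≡y) (inverseˡ σ))

    k<1+a : toℕ k < suc (toℕ a)
    k<1+a = subst (k Fin.<_) eq k<πy

    πx≡a : toℕ (π ⟨$⟩ˡ x) ≡ toℕ a
    πx≡a = ≡.trans (cong toℕ (inverseˡ π)) (Fin.toℕ-inject₁ a)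

    k<σx : k Fin.< σ ⟨$⟩ˡ x
    -- In π, x stands at place a, at or after k. At place k in σ it would be y; before k, agreement
    -- would put it before k in π as well.
    k<σx with Fin.<-cmp k (σ ⟨$⟩ˡ x)
    ... | tri< lt _ _ = lt
    ... | tri≈ _ k≡σx _ = contradiction
            (≡.trans (≡.sym πx≡a) (cong toℕ (≡.trans (cong (π ⟨$⟩ˡ_)
              (≡.trans (≡.sym (inverseʳ σ)) (cong (σ ⟨$⟩ʳ_) (≡.sym k≡σx)))) eq)))
            (ℕ.1+n≢n ∘ ≡.sym)
    ... | tri> _ _ gt = contradiction
            (subst (_< toℕ k) (≡.trans (cong toℕ (≡.sym (σ-agree x gt))) πx≡a) gt)
            (ℕ.≤⇒≯ (s≤s⁻¹ k<1+a))

    earlier : ∀ j → toℕ (σ ⟨$⟩ˡ j) ≤ toℕ k → position π j ≤ suc (suc (toℕ a))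
    earlier j σj≤k with ℕ.m≤n⇒m<n∨m≡n σj≤k
    ... | inj₁ σj<k = s≤s (ℕ.<⇒≤ (ℕ.<-trans (subst (Fin._< k) (≡.sym (σ-agree j σj<k)) σj<k) k<1+a))
    ... | inj₂ σj≡k = s≤s (ℕ.≤-reflexive (cong toℕ (≡.trans (cong (π ⟨$⟩ˡ_)
            (≡.trans (≡.sym (inverseʳ σ)) (cong (σ ⟨$⟩ʳ_) (Fin.toℕ-injective σj≡k)))) eq)))

-- Ordered ring arithmetic.

module Distance {c ℓ₁ ℓ₂} (R : OrderedRingWithHalf c ℓ₁ ℓ₂) where
  open OrderedRingWithHalf R
  open Weighted R
  open FiniteSums +-commutativeMonoid renaming (sum to sumᴿ)
  open CommutativeSemigroup +-commutativeSemigroup using (interchange; x∙yz≈y∙xz)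
  open Group +-group using (∙-cancelˡ; ∙-cancelʳ)

  poset : Poset c ℓ₁ ℓ₂
  poset = record { isPartialOrder = isPartialOrder }

  private
    module ≈-Reasoning = SetoidReasoning setoid
    module ≤-Reasoning = PartialOrderReasoning poset

  +-cancelˡ-≤ : ∀ z {x y} → z +ᴿ x ≤ᴿ z +ᴿ y → x ≤ᴿ y
  +-cancelˡ-≤ z {x} {y} z+x≤z+y = begin
    x               ≈⟨ undo x ⟨
    - z +ᴿ (z +ᴿ x) ≤⟨ +-mono-≤ Order.refl z+x≤z+y ⟩
    - z +ᴿ (z +ᴿ y) ≈⟨ undo y ⟩
    y               ∎
    where
    open ≤-Reasoning
    undo : ∀ w → - z +ᴿ (z +ᴿ w) ≈ᴿ w
    undo w = trans (sym (+-assoc (- z) z w)) (trans (+-congʳ (-‿inverseˡ z)) (+-identityˡ w))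

  x≤y+x : ∀ {x y} → 0# ≤ᴿ y → x ≤ᴿ y +ᴿ x
  x≤y+x {x} {y} 0≤y = begin
    x        ≈⟨ +-identityˡ x ⟨
    0# +ᴿ x  ≤⟨ +-mono-≤ 0≤y Order.refl ⟩
    y +ᴿ x   ∎
    where open ≤-Reasoning

  halves : ∀ x → ½ *ᴿ x +ᴿ ½ *ᴿ x ≈ᴿ x
  halves x = trans (sym (distribʳ x ½ ½)) (trans (*-congʳ ½+½≈1) (*-identityˡ x))

  sum-position : ∀ {n} (π : Ranking n) (f : ℕ → Carrier) →
                 sumᴿ (λ i → f (position π i)) ≈ᴿ sumᴿ (λ (p : Fin n) → f (suc (toℕ p)))
  sum-position {n} π f = sym (sum-permute {n} (λ p → f (suc (toℕ p))) (flip π))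

  -- Prefix sums of the weights.

  module _ {m} (φ : Weight m) where

    inRange? : ∀ p q (a : Fin m) → Dec (p ≤ suc (toℕ a) × suc (toℕ a) < q)
    inRange? p q a = (p ℕ.≤? suc (toℕ a)) ×-dec (suc (toℕ a) ℕ.<? q)

    term : ℕ → ℕ → Fin m → Carrier
    term p q a = if does (inRange? p q a) then φ a else 0#

    term-inside : ∀ p q a → p ≤ suc (toℕ a) → suc (toℕ a) < q → term p q a ≡ φ a
    term-inside p q a p≤a a<q = if-cong (dec-true (inRange? p q a) (p≤a , a<q))

    term-outside : ∀ p q a → ¬ (p ≤ suc (toℕ a) × suc (toℕ a) < q) → term p q a ≡ 0#
    term-outside p q a a∉ = if-cong (dec-false (inRange? p q a) a∉)

    Φ : ℕ → Carrier
    Φ q = sumᴿ (term 0 q)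

    -- Turns range sums into differences of prefix sums; `p ≤ q` places the prefix below p inside
    -- the one below q.
    ∑range-Φ : ∀ {p q} → p ≤ q → ∑range φ p q +ᴿ Φ p ≈ᴿ Φ q
    ∑range-Φ {p} {q} p≤q = begin
      ∑range φ p q +ᴿ Φ p                     ≈⟨ +-congʳ (foldr-filter-tabulate (inRange? p q) φ id) ⟩
      sumᴿ (term p q) +ᴿ Φ p                  ≈⟨ ∑-distrib-+ (term p q) (term 0 p) ⟨
      sumᴿ (λ a → term p q a +ᴿ term 0 p a)   ≈⟨ sum-cong-≋ {m} pointwise ⟩
      Φ q                                     ∎
      where
      open ≈-Reasoning
      pointwise : ∀ a → term p q a +ᴿ term 0 p a ≈ᴿ term 0 q a
      pointwise a with suc (toℕ a) ℕ.<? p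
      ... | yes a<p = trans
        (+-cong (reflexive (term-outside p q a λ (p≤a , _) → ℕ.<⇒≱ a<p p≤a))
                (reflexive (term-inside 0 p a z≤n a<p)))
        (trans (+-identityˡ _) (reflexive (≡.sym (term-inside 0 q a z≤n (ℕ.<-≤-trans a<p p≤q)))))
      ... | no a≮p = trans
        (+-cong (reflexive (if-cong (does-⇔ (mk⇔ (λ (_ , a<q) → z≤n , a<q) (λ (_ , a<q) → ℕ.≮⇒≥ a≮p , a<q))
                                            (inRange? p q a) (inRange? 0 q a))))
                (reflexive (term-outside 0 p a λ (_ , a<p) → a≮p a<p)))
        (+-identityʳ _)

    term-suc : ∀ q a → suc (toℕ a) ≢ q → term 0 (suc q) a ≡ term 0 q a
    term-suc q a a≢q = if-cong (does-⇔
      (mk⇔ (λ (_ , a<1+q) → z≤n , ℕ.≤∧≢⇒< (s≤s⁻¹ a<1+q) a≢q) (λ (_ , a<q) → z≤n , ℕ.m<n⇒m<1+n a<q))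
      (inRange? 0 (suc q) a) (inRange? 0 q a))

    Φ-suc : ∀ a → Φ (suc (suc (toℕ a))) ≈ᴿ φ a +ᴿ Φ (suc (toℕ a))
    Φ-suc a = begin
      Φ (suc q)                     ≈⟨ +-identityˡ _ ⟨
      0# +ᴿ Φ (suc q)               ≡⟨ cong (_+ᴿ Φ (suc q)) (term-outside 0 q a (ℕ.<-irrefl ≡.refl ∘ proj₂)) ⟨
      term 0 q a +ᴿ Φ (suc q)
        ≈⟨ sum-differ (term 0 (suc q)) (term 0 q) a
             (λ b b≢a → reflexive (term-suc q b (b≢a ∘ Fin.toℕ-injective ∘ ℕ.suc-injective))) ⟩
      term 0 (suc q) a +ᴿ Φ q       ≡⟨ cong (_+ᴿ Φ q) (term-inside 0 (suc q) a z≤n ℕ.≤-refl) ⟩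
      φ a +ᴿ Φ q                    ∎
      where
      open ≈-Reasoning
      q = suc (toℕ a)

    -- Weights exist only for j ≤ m, so the prefix sums are constant from m + 1 on, as if later
    -- weights were 0.
    Φ-beyond : ∀ {q} → m < q → Φ (suc q) ≈ᴿ Φ q
    Φ-beyond {q} m<q = sum-cong-≋ {m} λ a →
      reflexive (term-suc q a (ℕ.<⇒≢ (ℕ.≤-<-trans (Fin.toℕ<n a) m<q)))

    module _ (φ≥0 : NonNegative φ) (φ-decreasing : Decreasing φ) where

      -- The increment of `Φ` at q is the weight with index q, or 0 past m. Monotonicity of φ enters
      -- here only, to bound it by the earlier weight `φ a`.
      Φ-step : ∀ a {q} → suc (toℕ a) ≤ q → Φ q ≤ᴿ Φ (suc q) × Φ (suc q) ≤ᴿ φ a +ᴿ Φ q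
      Φ-step a {suc q} (s≤s a≤q) with q ℕ.<? m
      ... | no q≮m = Order.reflexive (sym beyond) , Order.trans (Order.reflexive beyond) (x≤y+x (φ≥0 a))
        where beyond = Φ-beyond (s≤s (ℕ.≮⇒≥ q≮m))
      ... | yes q<m = subst (λ q → Φ (suc q) ≤ᴿ Φ (suc (suc q)) × Φ (suc (suc q)) ≤ᴿ φ a +ᴿ Φ (suc q))
                            (Fin.toℕ-fromℕ< q<m)
                            ( Order.trans (x≤y+x (φ≥0 b)) (Order.reflexive (sym (Φ-suc b)))
                            , Order.trans (Order.reflexive (Φ-suc b)) (+-mono-≤ φb≤φa Order.refl))
        where
        b = fromℕ< q<m
        φb≤φa : φ b ≤ᴿ φ a
        φb≤φa with ℕ.m≤n⇒m<n∨m≡n (subst (toℕ a ≤_) (≡.sym (Fin.toℕ-fromℕ< q<m)) a≤q)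
        ... | inj₁ a<b = φ-decreasing b a a<b
        ... | inj₂ a≡b = Order.reflexive (reflexive (cong φ (≡.sym (Fin.toℕ-injective a≡b))))

      -- The potential `T`: lower bound and attainment.

      module _ (σ : Ranking (suc m)) where
        private
          S = position σ

        spanσ : Ranking (suc m) → Fin (suc m) → ℕ
        spanσ π = span (position π) S

        T : Ranking (suc m) → Carrier
        T π = sumᴿ (λ i → Φ (spanσ π i))

        C : Carrier
        C = sumᴿ (λ i → Φ (S i))

        -- Only the summand at y changes, its argument falling by one. Written without subtraction,
        -- like `sum-differ`.
        T-exchange : ∀ (π ρ : Ranking (suc m)) {x y} → Exchange (position π) (position ρ) x y → S y < S x →
                     Φ (spanσ ρ y) +ᴿ T π ≈ᴿ Φ (suc (spanσ ρ y)) +ᴿ T ρ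
        T-exchange π ρ {x} {y} e Sy<Sx = trans
          (sum-differ (λ i → Φ (spanσ π i)) (λ i → Φ (spanσ ρ i)) y
            (λ i i≢y → reflexive (cong Φ (span-unchanged e S Sy<Sx i i≢y))))
          (+-congʳ (reflexive (cong Φ (span-drops e S Sy<Sx))))

        T-step : ∀ π a → T π ≤ᴿ φ a +ᴿ T (π · adjacent a)
        T-step π a = step (ℕ.<-cmp (S y) (S x))
          where
          open ≤-Reasoning
          ρ = π · adjacent a
          x = π ⟨$⟩ʳ inject₁ a
          y = π ⟨$⟩ʳ suc a
          e = adjacent-exchange π a

          position-x : position π x ≡ suc (toℕ a)
          position-x = cong suc (≡.trans (cong toℕ (inverseˡ π)) (Fin.toℕ-inject₁ a))

          position-y : position π y ≡ suc (suc (toℕ a))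
          position-y = cong (suc ∘ toℕ) (inverseˡ π)

          step : Tri (S y < S x) (S y ≡ S x) (S x < S y) → T π ≤ᴿ φ a +ᴿ T ρ
          step (tri< Sy<Sx _ _) = +-cancelˡ-≤ (Φ q) (begin
            Φ q +ᴿ T π              ≈⟨ T-exchange π ρ e Sy<Sx ⟩
            Φ (suc q) +ᴿ T ρ        ≤⟨ +-mono-≤ (proj₂ (Φ-step a a<q)) Order.refl ⟩
            (φ a +ᴿ Φ q) +ᴿ T ρ     ≈⟨ +-assoc _ _ _ ⟩
            φ a +ᴿ (Φ q +ᴿ T ρ)     ≈⟨ x∙yz≈y∙xz _ _ _ ⟩
            Φ q +ᴿ (φ a +ᴿ T ρ)     ∎)
            where
            q = spanσ ρ y
            a<q : suc (toℕ a) ≤ q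
            -- Before the exchange y has position `suc (suc (toℕ a))`, which is at most its span
            -- `suc q`.
            a<q = s≤s⁻¹ (subst₂ _≤_ position-y (span-drops e S Sy<Sx) (position≤span π S y))
          step (tri≈ _ Sy≡Sx _) = contradiction
            (cong (position π) (position-injective σ (≡.sym Sy≡Sx))) (ℕ.<⇒≢ (Exchange.Px<Py e))
          -- This exchange creates a disagreement. Read backwards from ρ to π it removes one, so
          -- `T π` is at most `T ρ`.
          step (tri> _ _ Sx<Sy) = Order.trans (+-cancelˡ-≤ (Φ q) (begin
            Φ q +ᴿ T π              ≤⟨ +-mono-≤ (proj₁ (Φ-step a a<q)) Order.refl ⟩
            Φ (suc q) +ᴿ T π        ≈⟨ T-exchange ρ π (Exchange-sym e) Sx<Sy ⟨
            Φ q +ᴿ T ρ              ∎)) (x≤y+x (φ≥0 a))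
            where
            q = spanσ π x
            a<q : suc (toℕ a) ≤ q
            a<q = subst (_≤ q) position-x (position≤span π S x)

        T-base : ∀ π → σ ≈ π → T π ≈ᴿ C
        T-base π σ≈π = sum-cong-≋ {suc m} λ i → reflexive (cong Φ (≡.trans
          (span≡position π S i λ j → subst₂ _≤_ (≡.sym (P≗S j)) (≡.sym (P≗S i)))
          (P≗S i)))
          where P≗S = position-cong π σ σ≈π

        T-lower : ∀ τs π → A π σ τs → T π ≤ᴿ ∑ τs φ +ᴿ C
        T-lower []       π σ≈π = Order.reflexive (trans (T-base π σ≈π) (sym (+-identityˡ C)))
        -- `applyAll` is a left fold, so `A π σ (a ∷ τs)` unfolds to `A (π · adjacent a) σ τs` and
        -- `σ≈` is passed on unchanged.
        T-lower (a ∷ τs) π σ≈  = begin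
          T π                         ≤⟨ T-step π a ⟩
          φ a +ᴿ T (π · adjacent a)   ≤⟨ +-mono-≤ Order.refl (T-lower τs (π · adjacent a) σ≈) ⟩
          φ a +ᴿ (∑ τs φ +ᴿ C)        ≈⟨ +-assoc _ _ _ ⟨
          ∑ (a ∷ τs) φ +ᴿ C           ∎
          where open ≤-Reasoning

        -- Greedy sorting by tight exchanges. Each lowers the sum of all spans by exactly one, and
        -- `N` holds that sum as the induction measure.
        T-attained : ∀ N π → sum (spanσ π) ≡ N → ∃[ τs ] A π σ τs × T π ≈ᴿ ∑ τs φ +ᴿ C
        T-attained N π size with Fin.all? (λ i → π ⟨$⟩ʳ i Fin.≟ σ ⟨$⟩ʳ i)
        ... | yes π≈σ = [] , σ≈π , trans (T-base π σ≈π) (sym (+-identityˡ C))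
          where
          σ≈π : σ ≈ π
          σ≈π i = ≡.sym (π≈σ i)
        ... | no π≉σ with tight-exchange π σ π≉σ
        ...   | a , Sy<Sx , free = extend N size
          where
          open ≈-Reasoning
          ρ = π · adjacent a
          y = π ⟨$⟩ʳ suc a
          e = adjacent-exchange π a
          q = spanσ ρ y

          q≡ : q ≡ suc (toℕ a)
          -- Tightness makes the old span of y equal to its position `suc (suc (toℕ a))`, so the
          -- increment of `Φ` that is lost is exactly `φ a`.
          q≡ = ℕ.suc-injective (≡.trans (≡.sym (span-drops e S Sy<Sx))
                 (≡.trans (span≡position π S y free) (cong (suc ∘ toℕ) (inverseˡ π))))

          size-drops : sum (spanσ π) ≡ suc (sum (spanσ ρ))
          size-drops = ℕ.+-cancelˡ-≡ q _ _ (≡.trans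
            (ℕ-Sum.sum-differ (spanσ π) (spanσ ρ) y (span-unchanged e S Sy<Sx))
            (≡.trans (cong (_+ sum (spanσ ρ)) (span-drops e S Sy<Sx)) (≡.sym (ℕ.+-suc q _))))

          T-drops : T π ≈ᴿ φ a +ᴿ T ρ
          T-drops = ∙-cancelˡ (Φ q) _ _ (begin
            Φ q +ᴿ T π              ≈⟨ T-exchange π ρ e Sy<Sx ⟩
            Φ (suc q) +ᴿ T ρ        ≡⟨ cong (λ q → Φ (suc q) +ᴿ T ρ) q≡ ⟩
            Φ (suc (suc (toℕ a))) +ᴿ T ρ  ≈⟨ +-congʳ (Φ-suc a) ⟩
            (φ a +ᴿ Φ (suc (toℕ a))) +ᴿ T ρ ≡⟨ cong (λ q → (φ a +ᴿ Φ q) +ᴿ T ρ) q≡ ⟨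
            (φ a +ᴿ Φ q) +ᴿ T ρ     ≈⟨ +-assoc _ _ _ ⟩
            φ a +ᴿ (Φ q +ᴿ T ρ)     ≈⟨ x∙yz≈y∙xz _ _ _ ⟩
            Φ q +ᴿ (φ a +ᴿ T ρ)     ∎)

          extend : ∀ N → sum (spanσ π) ≡ N → ∃[ τs ] A π σ τs × T π ≈ᴿ ∑ τs φ +ᴿ C
          extend zero    size = contradiction (≡.trans (≡.sym size-drops) size) λ ()
          extend (suc N) size with T-attained N ρ (ℕ.suc-injective (≡.trans (≡.sym size-drops) size))
          ... | τs , σ≈ , Tρ≈ = a ∷ τs , σ≈ , (begin
            T π                     ≈⟨ T-drops ⟩
            φ a +ᴿ T ρ              ≈⟨ +-congˡ Tρ≈ ⟩
            φ a +ᴿ (∑ τs φ +ᴿ C)    ≈⟨ +-assoc _ _ _ ⟨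
            ∑ (a ∷ τs) φ +ᴿ C       ∎)

        -- The closed formula as `T π − C`.

        formula : Ranking (suc m) → Carrier
        formula π = ∑ (allFin (suc m)) (λ i →
          ½ *ᴿ (∑range φ (position π i) (ℓ π σ i) +ᴿ ∑range φ (position σ i) (ℓ π σ i)))

        -- By `∑range-Φ` the summand at i is `Φ` at the span of i less the mean of `Φ` at the two
        -- positions of i, and these means add up to `C`.
        formula+C≈T : ∀ π → formula π +ᴿ C ≈ᴿ T π
        formula+C≈T π = begin
          formula π +ᴿ C             ≈⟨ +-cong (foldr-tabulate half-ranges id) C≈ ⟩
          sumᴿ half-ranges +ᴿ sumᴿ (λ i → h (P i) +ᴿ h (S i))
            ≈⟨ ∑-distrib-+ half-ranges (λ i → h (P i) +ᴿ h (S i)) ⟨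
          sumᴿ (λ i → half-ranges i +ᴿ (h (P i) +ᴿ h (S i)))  ≈⟨ sum-cong-≋ {suc m} pointwise ⟩
          T π                        ∎
          where
          open ≈-Reasoning
          P = position π
          h : ℕ → Carrier
          h q = ½ *ᴿ Φ q

          half-ranges : Fin (suc m) → Carrier
          half-ranges i = ½ *ᴿ (∑range φ (P i) (ℓ π σ i) +ᴿ ∑range φ (S i) (ℓ π σ i))

          -- `C` is halved and one half moved from positions in σ to positions in π; both sums run
          -- over all places.
          C≈ : C ≈ᴿ sumᴿ (λ i → h (P i) +ᴿ h (S i))
          C≈ = begin
            C                                      ≈⟨ sum-cong-≋ {suc m} (λ i → halves (Φ (S i))) ⟨
            sumᴿ (λ i → h (S i) +ᴿ h (S i))        ≈⟨ ∑-distrib-+ (λ i → h (S i)) (λ i → h (S i)) ⟩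
            sumᴿ (λ i → h (S i)) +ᴿ sumᴿ (λ i → h (S i))
              ≈⟨ +-congʳ (trans (sum-position σ h) (sym (sum-position π h))) ⟩
            sumᴿ (λ i → h (P i)) +ᴿ sumᴿ (λ i → h (S i))  ≈⟨ ∑-distrib-+ (λ i → h (P i)) (λ i → h (S i)) ⟨
            sumᴿ (λ i → h (P i) +ᴿ h (S i))        ∎

          pointwise : ∀ i → half-ranges i +ᴿ (h (P i) +ᴿ h (S i)) ≈ᴿ Φ (spanσ π i)
          pointwise i = begin
            half-ranges i +ᴿ (h (P i) +ᴿ h (S i))
              ≡⟨ cong (λ q → ½ *ᴿ (∑range φ (P i) q +ᴿ ∑range φ (S i) q) +ᴿ (h (P i) +ᴿ h (S i))) (ℓ≡span π σ i) ⟩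
            ½ *ᴿ (r +ᴿ s) +ᴿ (h (P i) +ᴿ h (S i))                  ≈⟨ +-congʳ (distribˡ ½ r s) ⟩
            (½ *ᴿ r +ᴿ ½ *ᴿ s) +ᴿ (h (P i) +ᴿ h (S i))             ≈⟨ interchange _ _ _ _ ⟩
            (½ *ᴿ r +ᴿ h (P i)) +ᴿ (½ *ᴿ s +ᴿ h (S i))             ≈⟨ +-cong (distribˡ ½ r _) (distribˡ ½ s _) ⟨
            ½ *ᴿ (r +ᴿ Φ (P i)) +ᴿ ½ *ᴿ (s +ᴿ Φ (S i))
              ≈⟨ +-cong (*-congˡ (∑range-Φ (position≤span π S i)))
                        (*-congˡ (∑range-Φ (subst (S i ≤_) (span-comm S P i) (position≤span σ P i)))) ⟩
            ½ *ᴿ Φ u +ᴿ ½ *ᴿ Φ u                                   ≈⟨ halves (Φ u) ⟩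
            Φ u                                                    ∎
            where
            u = spanσ π i
            r = ∑range φ (P i) u
            s = ∑range φ (S i) u

        formula-isKendallDistance : ∀ π → IsKendallDistance φ π σ (formula π)
        formula-isKendallDistance π = attained , minimal
          where
          attained : TotalWeight φ π σ (formula π)
          attained with T-attained _ π ≡.refl
          ... | τs , σ≈ , T≈ = τs , σ≈ , ∙-cancelʳ C _ _ (trans (formula+C≈T π) T≈)

          minimal : ∀ w → TotalWeight φ π σ w → formula π ≤ᴿ w
          minimal w (τs , σ≈ , w≈) = +-cancelˡ-≤ C (begin
            C +ᴿ formula π   ≈⟨ +-comm _ _ ⟩
            formula π +ᴿ C   ≈⟨ formula+C≈T π ⟩
            T π              ≤⟨ T-lower τs π σ≈ ⟩
            ∑ τs φ +ᴿ C      ≈⟨ +-congʳ w≈ ⟨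
            w +ᴿ C           ≈⟨ +-comm _ _ ⟩
            C +ᴿ w           ∎)
            where open ≤-Reasoning

proposition12 : ∀ {c ℓ₁ ℓ₂} (R : OrderedRingWithHalf c ℓ₁ ℓ₂) →
    let open OrderedRingWithHalf R
        open Weighted R
    in
    ∀ (m : ℕ) (φ : Weight m) → NonNegative φ → Decreasing φ →
    ∀ (π σ : Ranking (suc m)) →
    IsKendallDistance φ π σ
      (∑ (allFin (suc m)) (λ i →
        ½ *ᴿ (∑range φ (position π i) (ℓ π σ i) +ᴿ ∑range φ (position σ i) (ℓ π σ i))))
proposition12 R m φ φ≥0 φ-decreasing π σ =
  Distance.formula-isKendallDistance R φ φ≥0 φ-decreasing σ π
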